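{- Let $\vdash$ be the consequence relation of the logic $IR4^\star$ and let $\mathrm{Fml}$ be the algebra of formulas in the language $\{\to\}$. For every $\Gamma\cup\{\alpha\}\subseteq\mathrm{Fml}$: $\Gamma\vdash\alpha$ if and only if for every sub-Hilbert algebra $A$ and every homomorphism $h:\mathrm{Fml}\to A$ (with respect to $\to$), $h(\Gamma)\subseteq\{1\}$ implies $h(\alpha)=1$.
   Context: The logic $IR4^\star$ is the Hilbert-style calculus in the language $\{\to\}$ with axiom schemes $\alpha\to\alpha$; $(\alpha\to\beta)\to((\beta\to\delta)\to(\alpha\to\delta))$; $(\alpha\to(\beta\to\delta))\to((\alpha\to\beta)\to(\alpha\to\delta))$; and rules (MP) from $\alpha$ and $\alpha\to\beta$ infer $\beta$; (T) from $\alpha$ infer $\beta\to\alpha$. $\Gamma\vdash\alpha$ means there is a finite derivation of $\alpha$ from premises in $\Gamma$ (both rules may be applied to any previously derived formulas, including those depending on premises). A sub-Hilbert algebra is an algebra $(A,\to,1)$ of type $(2,0)$ satisfying, for all $x,y,z\in A$: (B) $(x\to y)\to((y\to z)\to(x\to z))=1$; (I) $x\to x=1$; (T) $x\to 1=1$; (A) if $x\to y=1$ and $y\to x=1$ then $x=y$; (S) $(x\to(y\to z))\to((x\to y)\to(x\to z))=1$. -}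

module Defs where

open import Algebra.Bundles.Raw using (RawMagma)
open import Algebra.Morphism.Structures using (IsMagmaHomomorphism)
open import Algebra.Structures using (IsMagma)
open import Data.Nat.Base using (ℕ)
open import Level using (Level; 0ℓ; suc; _⊔_)
open import Relation.Binary.Core using (Rel)
open import Relation.Binary.PropositionalEquality.Core using (_≡_)
open import Relation.Unary using (Pred; _∈_)

infixr 6 _⇒_
infix 3 _⊢_

data Fml : Set where
  var : ℕ → Fml
  _⇒_ : Fml → Fml → Fml

fml : RawMagma 0ℓ 0ℓ
fml = record { Carrier = Fml ; _≈_ = _≡_ ; _∙_ = _⇒_ }

-- Both rules apply to arbitrary derived formulas, including ones that depend
-- on premises from Γ; in particular rule T is not restricted to theorems.
data _⊢_ {ℓ : Level} (Γ : Pred Fml ℓ) : Fml → Set ℓ where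
  premise : ∀ {α} → α ∈ Γ → Γ ⊢ α
  axI     : ∀ α → Γ ⊢ α ⇒ α
  axB     : ∀ α β δ → Γ ⊢ (α ⇒ β) ⇒ ((β ⇒ δ) ⇒ (α ⇒ δ))
  axS     : ∀ α β δ → Γ ⊢ (α ⇒ (β ⇒ δ)) ⇒ ((α ⇒ β) ⇒ (α ⇒ δ))
  ruleMP  : ∀ {α β} → Γ ⊢ α → Γ ⊢ α ⇒ β → Γ ⊢ β
  ruleT   : ∀ {α} β → Γ ⊢ α → Γ ⊢ β ⇒ α

-- As for the library's algebraic bundles, equality in the algebra is an
-- equivalence relation _≈_ on the carrier respected by the operation
-- (this is what isMagma says).
record SubHilbertAlgebra (a e : Level) : Set (suc (a ⊔ e)) where
  infix  4 _≈_
  infixr 6 _⟶_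
  field
    Carrier : Set a
    _≈_     : Rel Carrier e
    _⟶_     : Carrier → Carrier → Carrier
    𝟏       : Carrier
    isMagma : IsMagma _≈_ _⟶_
    B       : ∀ x y z → (x ⟶ y) ⟶ ((y ⟶ z) ⟶ (x ⟶ z)) ≈ 𝟏
    I       : ∀ x → x ⟶ x ≈ 𝟏
    T       : ∀ x → x ⟶ 𝟏 ≈ 𝟏
    A       : ∀ x y → x ⟶ y ≈ 𝟏 → y ⟶ x ≈ 𝟏 → x ≈ y
    S       : ∀ x y z → (x ⟶ (y ⟶ z)) ⟶ ((x ⟶ y) ⟶ (x ⟶ z)) ≈ 𝟏

  open IsMagma isMagma public

  rawMagma : RawMagma a e
  rawMagma = record { Carrier = Carrier ; _≈_ = _≈_ ; _∙_ = _⟶_ }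

IsHomomorphism : ∀ {a e} (𝐀 : SubHilbertAlgebra a e) →
                 (Fml → SubHilbertAlgebra.Carrier 𝐀) → Set e
IsHomomorphism 𝐀 = IsMagmaHomomorphism fml (SubHilbertAlgebra.rawMagma 𝐀)

{-# OPTIONS --safe #-}
-- Completeness is the Lindenbaum–Tarski argument: provable equivalence from Γ
-- is a congruence, and the derivable formulas form the class of 𝟏.  Because
-- rule T also applies to consequences of Γ, it prefixes an implication with any
-- formula, and axiom S then makes ⇒ monotone in its second argument.
module Submission where

open import Level using (Level; _⊔_; Lift; lift; lower)
open import Algebra.Morphism.Structures using (IsMagmaHomomorphism)
open import Data.Product.Base using (_×_; _,_; swap; proj₂)
open import Function.Bundles using (_⇔_; mk⇔)
open import Relation.Binary.Core using (Rel)
open import Relation.Binary.PropositionalEquality.Core using (refl)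
open import Relation.Unary using (Pred; _∈_)
open import Defs

module Soundness {a e ℓ : Level} {Γ : Pred Fml ℓ} (𝐀 : SubHilbertAlgebra a e)
  {h : Fml → SubHilbertAlgebra.Carrier 𝐀} (isHom : IsHomomorphism 𝐀 h) where

  open SubHilbertAlgebra 𝐀 renaming (trans to ≈-trans; sym to ≈-sym)
  open IsMagmaHomomorphism isHom using (homo)

  homo₂ : ∀ α β γ δ → h ((α ⇒ β) ⇒ (γ ⇒ δ)) ≈ (h α ⟶ h β) ⟶ (h γ ⟶ h δ)
  homo₂ α β γ δ = ≈-trans (homo _ _) (∙-cong (homo α β) (homo γ δ))

  -- Antisymmetry `A` applies because `T` supplies the converse `x ⟶ 𝟏 ≈ 𝟏`. This is what makes
  -- modus ponens sound.
  𝟏⟶x≈𝟏⇒x≈𝟏 : ∀ {x} → 𝟏 ⟶ x ≈ 𝟏 → x ≈ 𝟏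
  𝟏⟶x≈𝟏⇒x≈𝟏 {x} = A x 𝟏 (T x)

  soundness : ((γ : Fml) → γ ∈ Γ → h γ ≈ 𝟏) → ∀ {α} → Γ ⊢ α → h α ≈ 𝟏
  soundness hΓ≈𝟏 (premise γ∈Γ) = hΓ≈𝟏 _ γ∈Γ
  soundness hΓ≈𝟏 (axI α)       = ≈-trans (homo α α) (I (h α))
  soundness hΓ≈𝟏 (axB α β δ)   =
    ≈-trans (≈-trans (homo _ _) (∙-cong (homo α β) (homo₂ β δ α δ)))
            (B (h α) (h β) (h δ))
  soundness hΓ≈𝟏 (axS α β δ)   =
    ≈-trans (≈-trans (homo _ _)
                     (∙-cong (≈-trans (homo α _) (∙-congˡ (homo β δ)))
                             (homo₂ α β α δ)))
            (S (h α) (h β) (h δ))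
  soundness hΓ≈𝟏 (ruleMP {α} {β} ⊢α ⊢α⇒β) =
    𝟏⟶x≈𝟏⇒x≈𝟏 (≈-trans (∙-congʳ (≈-sym (soundness hΓ≈𝟏 ⊢α)))
                        (≈-trans (≈-sym (homo α β))
                                 (soundness hΓ≈𝟏 ⊢α⇒β)))
  soundness hΓ≈𝟏 (ruleT {α} β ⊢α) =
    ≈-trans (homo β α) (≈-trans (∙-congˡ (soundness hΓ≈𝟏 ⊢α)) (T (h β)))

module Lindenbaum {ℓ : Level} (Γ : Pred Fml ℓ) where

  infix 4 _⊣⊢_
  _⊣⊢_ : Rel Fml ℓ
  α ⊣⊢ β = (Γ ⊢ α ⇒ β) × (Γ ⊢ β ⇒ α)

  -- The language has no constant for truth; any derivable formula could represent `𝟏`, and `var 0`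
  -- is an arbitrary choice.
  ⊤ᶠ : Fml
  ⊤ᶠ = var 0 ⇒ var 0

  ⇒-trans : ∀ {α β δ} → Γ ⊢ α ⇒ β → Γ ⊢ β ⇒ δ → Γ ⊢ α ⇒ δ
  ⇒-trans p q = ruleMP q (ruleMP p (axB _ _ _))

  ⇒-mono : ∀ {α α′ β β′} → Γ ⊢ α′ ⇒ α → Γ ⊢ β ⇒ β′ → Γ ⊢ (α ⇒ β) ⇒ (α′ ⇒ β′)
  -- The chain passes through `α′ ⇒ β`: `axB` changes the antecedent, then `axS` distributes `α′`
  -- over `q`.
  ⇒-mono p q = ⇒-trans (ruleMP p (axB _ _ _)) (ruleMP (ruleT _ q) (axS _ _ _))

  ⊢⇒⊣⊢⊤ : ∀ {α} → Γ ⊢ α → α ⊣⊢ ⊤ᶠ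
  ⊢⇒⊣⊢⊤ p = ruleT _ (axI _) , ruleT _ p

  ⊣⊢⊤⇒⊢ : ∀ {α} → α ⊣⊢ ⊤ᶠ → Γ ⊢ α
  ⊣⊢⊤⇒⊢ p = ruleMP (axI _) (proj₂ p)

  -- Formulas themselves form the carrier, with `⊣⊢` as equality in place of a quotient. The lifts
  -- move the algebra to arbitrary levels `a` and `e ⊔ ℓ`.
  algebra : ∀ a e → SubHilbertAlgebra a (e ⊔ ℓ)
  algebra a e = record
    { Carrier = Lift a Fml
    ; _≈_     = λ x y → Lift e (lower x ⊣⊢ lower y)
    ; _⟶_     = λ x y → lift (lower x ⇒ lower y)
    ; 𝟏       = lift ⊤ᶠ
    ; isMagma = record
      { isEquivalence = record
        { refl  = lift (axI _ , axI _)
        ; sym   = λ p → lift (swap (lower p))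
        ; trans = λ { (lift (p , p′)) (lift (q , q′)) →
                      lift (⇒-trans p q , ⇒-trans q′ p′) }
        }
      ; ∙-cong = λ { (lift (p , p′)) (lift (q , q′)) →
                     lift (⇒-mono p′ q , ⇒-mono p q′) }
      }
    ; B = λ _ _ _ → lift (⊢⇒⊣⊢⊤ (axB _ _ _))
    ; I = λ _ → lift (⊢⇒⊣⊢⊤ (axI _))
    ; T = λ _ → lift (⊢⇒⊣⊢⊤ (ruleT _ (axI _)))
    -- An implication equal to `𝟏` is derivable from `Γ`, so the two hypotheses are exactly the two
    -- halves of `⊣⊢`.
    ; A = λ _ _ p q → lift (⊣⊢⊤⇒⊢ (lower p) , ⊣⊢⊤⇒⊢ (lower q))
    ; S = λ _ _ _ → lift (⊢⇒⊣⊢⊤ (axS _ _ _))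
    }

  lift-isHomomorphism : ∀ a e → IsHomomorphism (algebra a e) lift
  lift-isHomomorphism a e = record
    { isRelHomomorphism = record { cong = λ { refl → lift (axI _ , axI _) } }
    ; homo              = λ _ _ → lift (axI _ , axI _)
    }

corollary5p10 : (a e ℓ : Level) (Γ : Pred Fml ℓ) (α : Fml) →
    (Γ ⊢ α) ⇔
    ((𝐀 : SubHilbertAlgebra a (e ⊔ ℓ)) → let open SubHilbertAlgebra 𝐀 in
    (h : Fml → Carrier) → IsHomomorphism 𝐀 h →
    ((γ : Fml) → γ ∈ Γ → h γ ≈ 𝟏) → h α ≈ 𝟏)
corollary5p10 a e ℓ Γ α = mk⇔
  (λ ⊢α 𝐀 h isHom hΓ≈𝟏 → Soundness.soundness 𝐀 isHom hΓ≈𝟏 ⊢α)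
  -- The canonical valuation sends each formula to its own class. It sends every premise to `𝟏`, and
  -- a formula with value `𝟏` is derivable from `Γ`.
  (λ valid → ⊣⊢⊤⇒⊢ (lower (valid (algebra a e) lift (lift-isHomomorphism a e)
                                  (λ γ γ∈Γ → lift (⊢⇒⊣⊢⊤ (premise γ∈Γ))))))
  where open Lindenbaum Γ
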